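{- Let $m,n,p,c$ be positive integers. The number of lattice paths from $(0,0)$ to $(m-pn,m+n)$ using the steps $(1,1)$ and $(-p,1)$ in the plane that do not intersect the line $x=c$ equals $|\mathcal{L}_{p,c+pn-m}(0,0;n,m)|$, the number of lattice paths from $(0,0)$ to $(n,m)$ with unit steps $(1,0)$ and $(0,1)$ that stay strictly above the line $y=px-(c+pn-m)$.
   Context: A path with steps $(1,1)$ and $(-p,1)$ is regarded as the polygonal curve formed by its steps; it intersects the line $x=c$ if it touches or crosses that line. A path with steps $(1,0),(0,1)$ stays strictly above the line $y=px-v$ if every lattice point $(x,y)$ on it satisfies $y>px-v$. -}

module Defs where

open import Data.Integer.Base as ℤ using (ℤ; +_; -_; 0ℤ; 1ℤ)
open import Data.List.Base using (List; []; _∷_; length; foldl)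
open import Data.List.Membership.Propositional using (_∈_)
open import Data.List.Relation.Unary.All using (All)
open import Data.List.Relation.Unary.Unique.Propositional using (Unique)
open import Data.Nat.Base using (ℕ)
open import Data.Product.Base using (_×_; _,_; proj₁; ∃; ∃-syntax; zip)
open import Data.Rational.Base as ℚ using (ℚ; 0ℚ; 1ℚ)
open import Data.Rational.Literals using (fromℤ)
open import Data.Sum.Base using (_⊎_)
open import Function.Bundles using (_⇔_)
open import Level using (Level)
open import Relation.Binary.PropositionalEquality.Core using (_≡_)
open import Relation.Nullary.Negation.Core using (¬_)
open import Relation.Unary using (Pred)

private
  variable
    a ℓ : Level

-- P has exactly N elements: they are listed without repetition by a list of
-- length N.  (N is determined by P.)
_HasCardinality_ : {A : Set a} → Pred A ℓ → ℕ → Set _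
_HasCardinality_ {A = A} P N =
  ∃[ xs ] Unique xs × ((x : A) → (x ∈ xs) ⇔ P x) × length xs ≡ N

Point : Set
Point = ℤ × ℤ

infixl 6 _⊕_

_⊕_ : Point → Point → Point
_⊕_ = zip ℤ._+_ ℤ._+_

-- A lattice path is encoded by its starting point A together with the list of
-- its step vectors; these are its successive lattice points, A included.
vertices : Point → List Point → List Point
vertices A []       = A ∷ []
vertices A (s ∷ ss) = A ∷ vertices (A ⊕ s) ss

LatticePath : List Point → Point → Point → Pred (List Point) _
LatticePath S A B ss = All (_∈ S) ss × foldl _⊕_ A ss ≡ B

-- The polygonal curve is given by its rational points.  Real points are not
-- needed: a segment between lattice points with distinct abscissae (as is the
-- case for the steps (1,1) and (-p,1) with p > 0) meets a line x = c with c an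
-- integer in at most one point, and that point is rational.
OnSegment : Point → Point → Pred (ℚ × ℚ) _
OnSegment (x₀ , y₀) (x₁ , y₁) (x , y) =
  ∃[ t ] 0ℚ ℚ.≤ t × t ℚ.≤ 1ℚ
       × x ≡ (1ℚ ℚ.- t) ℚ.* fromℤ x₀ ℚ.+ t ℚ.* fromℤ x₁
       × y ≡ (1ℚ ℚ.- t) ℚ.* fromℤ y₀ ℚ.+ t ℚ.* fromℤ y₁

OnCurve : Point → List Point → Pred (ℚ × ℚ) _
OnCurve (x₀ , y₀) []       P = P ≡ (fromℤ x₀ , fromℤ y₀)
OnCurve A         (s ∷ ss) P = OnSegment A (A ⊕ s) P ⊎ OnCurve (A ⊕ s) ss P

-- Touching or crossing the line x = c.
IntersectsVertical : ℤ → Point → Pred (List Point) _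
IntersectsVertical c A ss = ∃[ P ] OnCurve A ss P × proj₁ P ≡ fromℤ c

slantedSteps : ℕ → List Point
slantedSteps p = (1ℤ , 1ℤ) ∷ (- (+ p) , 1ℤ) ∷ []

unitSteps : List Point
unitSteps = (1ℤ , 0ℤ) ∷ (0ℤ , 1ℤ) ∷ []

SlantedPathAvoiding : ℕ → ℤ → Point → Point → Pred (List Point) _
SlantedPathAvoiding p c A B ss =
  LatticePath (slantedSteps p) A B ss × ¬ IntersectsVertical c A ss

-- Strictly above the line y = p x - v.
StrictlyAbove : ℕ → ℤ → Pred Point _
StrictlyAbove p v (x , y) = y ℤ.> + p ℤ.* x ℤ.- v

-- The set 𝓛_{p,v}(A; B).
𝓛 : ℕ → ℤ → Point → Point → Pred (List Point) _
𝓛 p v A B ss = LatticePath unitSteps A B ss × All (StrictlyAbove p v) (vertices A ss)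

{-# OPTIONS --safe #-}
-- Slanted paths are images of unit-step paths under the injective linear map
-- slant (x , y) = (y - p x , x + y), which sends (0 , 1) to (1 , 1) and (1 , 0)
-- to (-p , 1); the correspondence reverses the order of the steps.  If the
-- vertex u of a unit-step path from the origin to B corresponds to the vertex v
-- of the reversed path, then u ⊕ v ≡ B, and slant v has abscissa less than c
-- exactly when u lies strictly above the line.  As the only steps to the right
-- have length 1, a slanted path starting to the left of x = c avoids that line
-- exactly when all its vertices stay to the left of it.
module Submission where

open import Defs
open import Data.Integer.Base as ℤ using (ℤ; +_; 0ℤ; 1ℤ; _+_; _-_; _*_)
open import Data.Integer.Properties as ℤ using ()
open import Data.Integer.Tactic.RingSolver using (solve-∀)
open import Data.List.Base using (List; []; _∷_; _∷ʳ_; length; foldl; map; filter; reverse; cartesianProductWith)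
open import Data.List.Membership.Propositional using (_∈_)
open import Data.List.Membership.Propositional.Properties
  using (∈-map⁺; ∈-map⁻; ∈-filter⁺; ∈-filter⁻; ∈-cartesianProductWith⁺)
open import Data.List.Properties
  using (∷-injective; foldl-∷ʳ; length-map; unfold-reverse; reverse-involutive; reverse-injective; map-injective)
open import Data.List.Relation.Unary.All as All using (All; []; _∷_; all?)
open import Data.List.Relation.Unary.All.Properties as All using ()
open import Data.List.Relation.Binary.Permutation.Propositional using (↭-sym)
open import Data.List.Relation.Binary.Permutation.Propositional.Properties using (All-resp-↭; ↭-reverse)
open import Data.List.Relation.Unary.Any using (here; there)
open import Data.List.Relation.Unary.Unique.Propositional using (Unique; []; _∷_)
import Data.List.Relation.Unary.Unique.Propositional.Properties as Unique
open import Data.Nat.Base as ℕ using (ℕ; zero; suc; NonZero; z<s)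
open import Data.Product.Base using (_×_; _,_; proj₁; proj₂; ∃-syntax)
open import Data.Product.Properties using (≡-dec)
open import Data.Rational.Base as ℚ using (ℚ; 0ℚ; 1ℚ; *<*; *≤*; nonNegative)
import Data.Rational.Properties as ℚ
open import Data.Rational.Literals using (fromℤ)
open import Data.Rational.Solver using (module +-*-Solver)
open import Data.Sum.Base using (inj₁; inj₂)
open import Function.Base using (_∘_)
open import Function.Bundles using (_⇔_; mk⇔; module Equivalence)
open import Function.Definitions using (Injective)
open import Level using (Level)
open import Relation.Binary.Definitions using (DecidableEquality)
open import Relation.Binary.PropositionalEquality
open import Relation.Nullary.Decidable using (_×-dec_)
open import Relation.Nullary.Negation using (¬_)
open import Relation.Unary using (Pred; Decidable)

open import Algebra.Properties.AbelianGroup ℤ.+-0-abelianGroup using () renaming (∙-cancelˡ to +-cancelˡ)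

open Equivalence using (to; from)

private
  variable
    a b ℓ ℓ′ : Level

-- Cardinalities, and words over a finite alphabet.

module _ {A : Set a} {P : Pred A ℓ} where

  hasCardinality-filter : (P? : Decidable P) {xs : List A} → Unique xs → (∀ {x} → P x → x ∈ xs) →
                          P HasCardinality length (filter P? xs)
  hasCardinality-filter P? {xs} xs! complete =
    filter P? xs , Unique.filter⁺ P? xs! ,
    (λ x → mk⇔ (proj₂ ∘ ∈-filter⁻ P? {xs = xs}) λ Px → ∈-filter⁺ P? (complete Px) Px) , refl

  -- Injectivity keeps the mapped list free of repetitions, and `preimage` shows that it misses no
  -- element of `Q`.
  hasCardinality-image : {B : Set b} {Q : Pred B ℓ′} {f : A → B} {N : ℕ} → Injective _≡_ _≡_ f →
                         (∀ {x} → P x → Q (f x)) → (∀ {y} → Q y → ∃[ x ] P x × y ≡ f x) →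
                         P HasCardinality N → Q HasCardinality N
  hasCardinality-image {Q = Q} {f} f-injective image preimage (xs , xs! , xs⇔P , refl) =
    map f xs , Unique.map⁺ f-injective xs! , (λ y → mk⇔ sound complete) , length-map f xs
    where
    sound : ∀ {y} → y ∈ map f xs → Q y
    sound y∈ with x , x∈ , refl ← ∈-map⁻ f y∈ = image (to (xs⇔P x) x∈)

    complete : ∀ {y} → Q y → y ∈ map f xs
    complete Qy with x , Px , refl ← preimage Qy = ∈-map⁺ f (from (xs⇔P x) Px)

all-reverse : {A : Set a} {P : Pred A ℓ} {xs : List A} → All P xs → All P (reverse xs)
all-reverse {xs = xs} = All-resp-↭ (↭-sym (↭-reverse xs))

module _ {A : Set a} where

  words : List A → ℕ → List (List A)
  words S zero    = [] ∷ []
  words S (suc k) = cartesianProductWith _∷_ S (words S k)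

  words-unique : {S : List A} → Unique S → ∀ k → Unique (words S k)
  words-unique S! zero    = [] ∷ []
  words-unique S! (suc k) = Unique.cartesianProductWith⁺ _∷_ ∷-injective S! (words-unique S! k)

  words-complete : {S ss : List A} → All (_∈ S) ss → ss ∈ words S (length ss)
  words-complete []         = here refl
  words-complete (s∈ ∷ ss∈) = ∈-cartesianProductWith⁺ _∷_ s∈ (words-complete ss∈)

-- Lattice paths under translation, reversal and additive maps.

origin : Point
origin = 0ℤ , 0ℤ

⊕-assoc : ∀ u v w → (u ⊕ v) ⊕ w ≡ u ⊕ (v ⊕ w)
⊕-assoc (x , y) (x′ , y′) (x″ , y″) = cong₂ _,_ (ℤ.+-assoc x x′ x″) (ℤ.+-assoc y y′ y″)

⊕-comm : ∀ u v → u ⊕ v ≡ v ⊕ u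
⊕-comm (x , y) (x′ , y′) = cong₂ _,_ (ℤ.+-comm x x′) (ℤ.+-comm y y′)

⊕-identityʳ : ∀ u → u ⊕ origin ≡ u
⊕-identityʳ (x , y) = cong₂ _,_ (ℤ.+-identityʳ x) (ℤ.+-identityʳ y)

foldl-⊕ : ∀ A B ss → foldl _⊕_ (A ⊕ B) ss ≡ A ⊕ foldl _⊕_ B ss
foldl-⊕ A B []       = refl
foldl-⊕ A B (s ∷ ss) = trans (cong (λ v → foldl _⊕_ v ss) (⊕-assoc A B s)) (foldl-⊕ A (B ⊕ s) ss)

foldl-origin : ∀ A ss → A ⊕ foldl _⊕_ origin ss ≡ foldl _⊕_ A ss
foldl-origin A ss =
  trans (sym (foldl-⊕ A origin ss)) (cong (λ v → foldl _⊕_ v ss) (⊕-identityʳ A))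

foldl-reverse : ∀ A ss → foldl _⊕_ A (reverse ss) ≡ foldl _⊕_ A ss
foldl-reverse A []       = refl
foldl-reverse A (s ∷ ss) = begin
  foldl _⊕_ A (reverse (s ∷ ss))   ≡⟨ cong (foldl _⊕_ A) (unfold-reverse s ss) ⟩
  foldl _⊕_ A (reverse ss ∷ʳ s)    ≡⟨ foldl-∷ʳ _⊕_ A s (reverse ss) ⟩
  foldl _⊕_ A (reverse ss) ⊕ s     ≡⟨ cong (_⊕ s) (foldl-reverse A ss) ⟩
  foldl _⊕_ A ss ⊕ s               ≡⟨ ⊕-comm _ s ⟩
  s ⊕ foldl _⊕_ A ss               ≡⟨ foldl-⊕ s A ss ⟨
  foldl _⊕_ (s ⊕ A) ss             ≡⟨ cong (λ v → foldl _⊕_ v ss) (⊕-comm s A) ⟩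
  foldl _⊕_ (A ⊕ s) ss             ∎
  where open ≡-Reasoning

vertices-∷ʳ : ∀ A ss s → vertices A (ss ∷ʳ s) ≡ vertices A ss ∷ʳ foldl _⊕_ A (ss ∷ʳ s)
vertices-∷ʳ A []       s = refl
vertices-∷ʳ A (r ∷ ss) s = cong (A ∷_) (vertices-∷ʳ (A ⊕ r) ss s)

-- Induction on the steps with a varying start `A`. The reversed path always starts at the origin;
-- putting `s` in front of `ss` adds one vertex at its far end. This vertex is the sum of all steps,
-- so it is the one complementary to `A`.
all-vertices-reverse : {P : Pred Point ℓ} {Q : Pred Point ℓ′} → ∀ A ss →
                       (∀ u v → u ⊕ v ≡ foldl _⊕_ A ss → Q u → P v) →
                       All Q (vertices A ss) → All P (vertices origin (reverse ss))
all-vertices-reverse A []       Q⇒P (q ∷ []) = Q⇒P A origin (⊕-identityʳ A) q ∷ []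
all-vertices-reverse {P = P} A (s ∷ ss) Q⇒P (q ∷ qs) =
  subst (All P) (sym vertices-split)
    (All.∷ʳ⁺ (all-vertices-reverse (A ⊕ s) ss Q⇒P qs) (Q⇒P A _ complement q))
  where
  vertices-split : vertices origin (reverse (s ∷ ss)) ≡
                   vertices origin (reverse ss) ∷ʳ foldl _⊕_ origin (reverse (s ∷ ss))
  vertices-split rewrite unfold-reverse s ss = vertices-∷ʳ origin (reverse ss) s

  complement : A ⊕ foldl _⊕_ origin (reverse (s ∷ ss)) ≡ foldl _⊕_ A (s ∷ ss)
  complement = trans (foldl-origin A (reverse (s ∷ ss))) (foldl-reverse A (s ∷ ss))

module _ (f : Point → Point) (f-⊕ : ∀ u v → f (u ⊕ v) ≡ f u ⊕ f v) where

  foldl-map-⊕ : ∀ A ss → foldl _⊕_ (f A) (map f ss) ≡ f (foldl _⊕_ A ss)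
  foldl-map-⊕ A []       = refl
  foldl-map-⊕ A (s ∷ ss) =
    trans (cong (λ v → foldl _⊕_ v (map f ss)) (sym (f-⊕ A s))) (foldl-map-⊕ (A ⊕ s) ss)

  vertices-map : ∀ A ss → vertices (f A) (map f ss) ≡ map f (vertices A ss)
  vertices-map A []       = refl
  vertices-map A (s ∷ ss) =
    cong (f A ∷_)
      (trans (cong (λ v → vertices v (map f ss)) (sym (f-⊕ A s))) (vertices-map (A ⊕ s) ss))

-- Decidability and finiteness of `𝓛`.

_≟ᴾ_ : DecidableEquality Point
_≟ᴾ_ = ≡-dec ℤ._≟_ ℤ._≟_

open import Data.List.Membership.DecPropositional _≟ᴾ_ using (_∈?_)

𝓛? : ∀ p v A B → Decidable (𝓛 p v A B)
𝓛? p v A B ss = (all? (_∈? unitSteps) ss ×-dec (foldl _⊕_ A ss ≟ᴾ B))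
                ×-dec all? (λ (x , y) → (+ p * x - v) ℤ.<? y) (vertices A ss)

height : Point → ℤ
height (x , y) = x + y

-- Every unit step raises the sum of the coordinates by exactly one. Hence the endpoint fixes the
-- length of a path, which bounds the search for paths.
height-unitPath : ∀ A {ss} → All (_∈ unitSteps) ss → height (foldl _⊕_ A ss) ≡ height A + + length ss
height-unitPath A [] = sym (ℤ.+-identityʳ (height A))
height-unitPath A {s ∷ ss} (s∈ ∷ ss∈) = begin
  height (foldl _⊕_ (A ⊕ s) ss)    ≡⟨ height-unitPath (A ⊕ s) ss∈ ⟩
  height (A ⊕ s) + + length ss     ≡⟨ cong (_+ + length ss) (height-step A s∈) ⟩
  (height A + 1ℤ) + + length ss    ≡⟨ ℤ.+-assoc (height A) 1ℤ (+ length ss) ⟩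
  height A + + suc (length ss)     ∎
  where
  open ≡-Reasoning

  +-right : ∀ x y → (x + 1ℤ) + (y + 0ℤ) ≡ (x + y) + 1ℤ
  +-right = solve-∀

  +-up : ∀ x y → (x + 0ℤ) + (y + 1ℤ) ≡ (x + y) + 1ℤ
  +-up = solve-∀

  height-step : ∀ A {s} → s ∈ unitSteps → height (A ⊕ s) ≡ height A + 1ℤ
  height-step (x , y) (here refl)         = +-right x y
  height-step (x , y) (there (here refl)) = +-up x y

-- Every path in question is a word of length n + m over the two steps, so the set is cut out of a
-- finite list by a decidable test.
𝓛-finite : ∀ p v n m → ∃[ N ] 𝓛 p v origin (+ n , + m) HasCardinality N
𝓛-finite p v n m = _ , hasCardinality-filter (𝓛? p v _ _) (words-unique unitSteps! (n ℕ.+ m)) complete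
  where
  unitSteps! : Unique unitSteps
  unitSteps! = ((λ ()) ∷ []) ∷ [] ∷ []

  complete : ∀ {ss} → 𝓛 p v origin (+ n , + m) ss → ss ∈ words unitSteps (n ℕ.+ m)
  complete {ss} ((ss∈ , end) , _) = subst (λ k → ss ∈ words unitSteps k) length≡ (words-complete ss∈)
    where
    length≡ : length ss ≡ n ℕ.+ m
    length≡ = ℤ.+-injective (trans (sym (height-unitPath origin ss∈)) (cong height end))

-- The polygonal curve and its vertices relative to a vertical line.

fromℤ-mono-≤ : ∀ {i j} → i ℤ.≤ j → fromℤ i ℚ.≤ fromℤ j
fromℤ-mono-≤ i≤j = *≤* (ℤ.*-monoʳ-≤-nonNeg 1ℤ i≤j)

fromℤ-mono-< : ∀ {i j} → i ℤ.< j → fromℤ i ℚ.< fromℤ j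
fromℤ-mono-< i<j = *<* (ℤ.*-monoʳ-<-pos 1ℤ i<j)

convex-≤ : ∀ {t q r s} → 0ℚ ℚ.≤ t → t ℚ.≤ 1ℚ → q ℚ.≤ s → r ℚ.≤ s →
           (1ℚ ℚ.- t) ℚ.* q ℚ.+ t ℚ.* r ℚ.≤ s
convex-≤ {t} {q} {r} {s} 0≤t t≤1 q≤s r≤s = begin
  (1ℚ ℚ.- t) ℚ.* q ℚ.+ t ℚ.* r
    ≤⟨ ℚ.+-mono-≤ (ℚ.*-monoˡ-≤-nonNeg (1ℚ ℚ.- t) {{nonNegative 0≤1-t}} q≤s)
                  (ℚ.*-monoˡ-≤-nonNeg t {{nonNegative 0≤t}} r≤s) ⟩
  (1ℚ ℚ.- t) ℚ.* s ℚ.+ t ℚ.* s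
    ≡⟨ solve 2 (λ t s → (con 1ℚ :- t) :* s :+ t :* s := s) refl t s ⟩
  s ∎
  where
  open ℚ.≤-Reasoning
  open +-*-Solver

  0≤1-t : 0ℚ ℚ.≤ 1ℚ ℚ.- t
  0≤1-t = subst (ℚ._≤ 1ℚ ℚ.- t) (ℚ.+-inverseʳ t) (ℚ.+-monoˡ-≤ (ℚ.- t) t≤1)

LeftOf : ℤ → Pred Point _
LeftOf c (x , _) = x ℤ.< c

-- Integer abscissae less than `c` are at most c - 1. A convex combination of two of them is then at
-- most c - 1 as well, which gives strictness without distinguishing cases on the parameter `t`.
curve-leftOf : ∀ c A ss → All (LeftOf c) (vertices A ss) → ∀ {x y} → OnCurve A ss (x , y) → x ℚ.< fromℤ c
curve-leftOf c A []       (A<c ∷ _)    refl = fromℤ-mono-< A<c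
curve-leftOf c A (s ∷ ss) (_ ∷ vs<c)   (inj₂ on-tail) = curve-leftOf c (A ⊕ s) ss vs<c on-tail
curve-leftOf c A (s ∷ ss) (A<c ∷ vs<c) (inj₁ (t , 0≤t , t≤1 , refl , _)) =
  ℚ.≤-<-trans (convex-≤ 0≤t t≤1 (below A<c) (below (next vs<c))) (fromℤ-mono-< (ℤ.i≤pred[j]⇒i<j ℤ.≤-refl))
  where
  below : ∀ {i} → i ℤ.< c → fromℤ i ℚ.≤ fromℤ (ℤ.pred c)
  below i<c = fromℤ-mono-≤ (ℤ.i<j⇒i≤pred[j] i<c)

  -- `B` heads the vertex list in either case, but the list only reduces once `rs` is split.
  next : ∀ {B rs} → All (LeftOf c) (vertices B rs) → LeftOf c B
  next {rs = []}    (B<c ∷ _) = B<c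
  next {rs = _ ∷ _} (B<c ∷ _) = B<c

-- The parameter 0 on the first segment gives the start. Through this, a vertex on the line x = c
-- counts as an intersection.
start-onCurve : ∀ A ss → OnCurve A ss (fromℤ (proj₁ A) , fromℤ (proj₂ A))
start-onCurve A []       = refl
start-onCurve (x , y) ((x′ , y′) ∷ ss) =
  inj₁ (0ℚ , ℚ.≤-refl , ℚ.nonNegative⁻¹ 1ℚ ,
        at-0 (fromℤ x) (fromℤ (x + x′)) , at-0 (fromℤ y) (fromℤ (y + y′)))
  where
  open +-*-Solver

  at-0 : ∀ q r → q ≡ (1ℚ ℚ.- 0ℚ) ℚ.* q ℚ.+ 0ℚ ℚ.* r
  at-0 = solve 2 (λ q r → q := (con 1ℚ :- con 0ℚ) :* q :+ con 0ℚ :* r) refl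

module _ (p : ℕ) (c : ℤ) where

  slantedStep-≤ : ∀ {A s} → s ∈ slantedSteps p → LeftOf c A → proj₁ (A ⊕ s) ℤ.≤ c
  slantedStep-≤ {x , _} (here refl)         x<c = subst (ℤ._≤ c) (ℤ.+-comm 1ℤ x) (ℤ.i<j⇒suc[i]≤j x<c)
  slantedStep-≤ {x , _} (there (here refl)) x<c = ℤ.≤-trans (ℤ.i-j≤i x (+ p)) (ℤ.<⇒≤ x<c)

  -- From a vertex left of the line, one step reaches abscissa `c` at most. Equality would put the
  -- next vertex, a point of the curve, on the line; so the next vertex is again to the left and the
  -- induction goes on.
  avoiding⇒leftOf : ∀ A {ss} → All (_∈ slantedSteps p) ss → LeftOf c A →
                    ¬ IntersectsVertical c A ss → All (LeftOf c) (vertices A ss)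
  avoiding⇒leftOf A [] A<c _ = A<c ∷ []
  avoiding⇒leftOf A {s ∷ ss} (s∈ ∷ ss∈) A<c avoids =
    A<c ∷ avoiding⇒leftOf (A ⊕ s) ss∈ (ℤ.≤∧≢⇒< (slantedStep-≤ {A} s∈ A<c) next≢c) avoids-tail
    where
    avoids-tail : ¬ IntersectsVertical c (A ⊕ s) ss
    avoids-tail (P , on-tail , P≡c) = avoids (P , inj₂ on-tail , P≡c)

    next≢c : proj₁ (A ⊕ s) ≢ c
    next≢c next≡c = avoids-tail (_ , start-onCurve (A ⊕ s) ss , cong fromℤ next≡c)

leftOf⇒avoiding : ∀ c A ss → All (LeftOf c) (vertices A ss) → ¬ IntersectsVertical c A ss
leftOf⇒avoiding c A ss vs<c (_ , on , x≡c) = ℚ.<-irrefl x≡c (curve-leftOf c A ss vs<c on)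

-- The linear map and the correspondence between the two kinds of paths.

+-cancelʳ-< : ∀ k {i j} → i + k ℤ.< j + k → i ℤ.< j
+-cancelʳ-< k i+k<j+k = ℤ.≰⇒> λ j≤i → ℤ.<⇒≱ i+k<j+k (ℤ.+-monoˡ-≤ k j≤i)

module _ (p : ℕ) where

  slant : Point → Point
  slant (x , y) = y - + p * x , x + y

  slant-⊕ : ∀ u v → slant (u ⊕ v) ≡ slant u ⊕ slant v
  slant-⊕ (x , y) (x′ , y′) = cong₂ _,_ (fst (+ p) x y x′ y′) (snd x y x′ y′)
    where
    fst : ∀ p x y x′ y′ → (y + y′) - p * (x + x′) ≡ (y - p * x) + (y′ - p * x′)
    fst = solve-∀

    snd : ∀ x y x′ y′ → (x + x′) + (y + y′) ≡ (x + y) + (x′ + y′)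
    snd = solve-∀

  slant-origin : slant origin ≡ origin
  slant-origin = cong (λ i → 0ℤ - i , 0ℤ) (ℤ.*-zeroʳ (+ p))

  -- The second coordinate of the image minus the first is (1 + p) x, with 1 + p nonzero; this
  -- recovers x, and the second coordinate x + y then recovers y.
  slant-injective : Injective _≡_ _≡_ slant
  slant-injective {x , y} {x′ , y′} eq = cong₂ _,_ x≡x′ y≡y′
    where
    x-multiple : ∀ p x y → (1ℤ + p) * x ≡ (x + y) - (y - p * x)
    x-multiple = solve-∀

    x≡x′ : x ≡ x′
    x≡x′ = ℤ.*-cancelˡ-≡ (+ suc p) x x′ (begin
      + suc p * x                    ≡⟨ x-multiple (+ p) x y ⟩
      (x + y) - (y - + p * x)        ≡⟨ cong₂ _-_ (cong proj₂ eq) (cong proj₁ eq) ⟩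
      (x′ + y′) - (y′ - + p * x′)    ≡⟨ x-multiple (+ p) x′ y′ ⟨
      + suc p * x′                   ∎)
      where open ≡-Reasoning

    y≡y′ : y ≡ y′
    y≡y′ = +-cancelˡ x y y′ (trans (cong proj₂ eq) (cong (_+ y′) (sym x≡x′)))

  slant-right : slant (1ℤ , 0ℤ) ≡ (ℤ.- (+ p) , 1ℤ)
  slant-right = cong (_, 1ℤ) (trans (ℤ.+-identityˡ _) (cong ℤ.-_ (ℤ.*-identityʳ (+ p))))

  slant-up : slant (0ℤ , 1ℤ) ≡ (1ℤ , 1ℤ)
  slant-up = cong (λ i → 1ℤ - i , 1ℤ) (ℤ.*-zeroʳ (+ p))

  -- The two step lists are in opposite order, so `here` and `there` are exchanged.
  slant-step : ∀ {s} → s ∈ unitSteps → slant s ∈ slantedSteps p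
  slant-step (here refl)         = there (here slant-right)
  slant-step (there (here refl)) = here slant-up

  unslant-steps : ∀ {ss} → All (_∈ slantedSteps p) ss → ∃[ rs ] All (_∈ unitSteps) rs × ss ≡ map slant rs
  unslant-steps [] = [] , [] , refl
  unslant-steps (s∈ ∷ ss∈) with unslant-steps ss∈ | s∈
  ... | rs , rs∈ , refl | here refl         = _ ∷ rs , there (here refl) ∷ rs∈ , cong (_∷ map slant rs) (sym slant-up)
  ... | rs , rs∈ , refl | there (here refl) = _ ∷ rs , here refl ∷ rs∈ , cong (_∷ map slant rs) (sym slant-right)

  foldl-slant : ∀ ss → foldl _⊕_ origin (map slant ss) ≡ slant (foldl _⊕_ origin ss)
  foldl-slant ss =
    trans (cong (λ v → foldl _⊕_ v (map slant ss)) (sym slant-origin)) (foldl-map-⊕ slant slant-⊕ origin ss)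

  vertices-slant : ∀ ss → vertices origin (map slant ss) ≡ map slant (vertices origin ss)
  vertices-slant ss =
    trans (cong (λ v → vertices v (map slant ss)) (sym slant-origin)) (vertices-map slant slant-⊕ origin ss)

  module _ (c n m : ℤ) where

    private
      v : ℤ
      v = c + + p * n - m

    -- Adding y - c to both sides of y′ - p x′ < c yields p x - v < y, since n = x + x′ and m = y +
    -- y′. Matching on `refl` performs these substitutions, leaving polynomial identities.
    complement-leftOf : ∀ u w → u ⊕ w ≡ (n , m) → StrictlyAbove p v u ⇔ LeftOf c (slant w)
    complement-leftOf (x , y) (x′ , y′) refl = mk⇔
      (λ above → +-cancelʳ-< (y - c) (subst₂ ℤ._<_ (sym line-shifted) (sym (c-shifted c y)) above))
      (λ left → subst₂ ℤ._<_ line-shifted (c-shifted c y) (ℤ.+-monoˡ-< (y - c) left))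
      where
      c-shifted : ∀ c y → c + (y - c) ≡ y
      c-shifted = solve-∀

      identity : ∀ p c x y x′ y′ →
                 (y′ - p * x′) + (y - c) ≡ p * x - (c + p * (x + x′) - (y + y′))
      identity = solve-∀

      line-shifted : (y′ - + p * x′) + (y - c) ≡ + p * x - (c + + p * (x + x′) - (y + y′))
      line-shifted = identity (+ p) c x y x′ y′

    slant-avoiding : ∀ {ss} → 𝓛 p v origin (n , m) ss →
                     SlantedPathAvoiding p c origin (slant (n , m)) (map slant (reverse ss))
    slant-avoiding {ss} ((ss∈ , end) , above) =
      (All.gmap⁺ slant-step (all-reverse ss∈) , slanted-end) , leftOf⇒avoiding c _ _ left
      where
      slanted-end : foldl _⊕_ origin (map slant (reverse ss)) ≡ slant (n , m)
      slanted-end = trans (foldl-slant (reverse ss)) (cong slant (trans (foldl-reverse origin ss) end))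

      left : All (LeftOf c) (vertices origin (map slant (reverse ss)))
      left = subst (All (LeftOf c)) (sym (vertices-slant (reverse ss))) (All.map⁺
        (all-vertices-reverse origin ss (λ u w u⊕w → to (complement-leftOf u w (trans u⊕w end))) above))

    -- The preimage is found by undoing the map step by step and then reversing.
    unslant-avoiding : 0ℤ ℤ.< c → ∀ {ss} → SlantedPathAvoiding p c origin (slant (n , m)) ss →
                       ∃[ rs ] 𝓛 p v origin (n , m) rs × ss ≡ map slant (reverse rs)
    unslant-avoiding 0<c {ss} ((ss∈ , slanted-end) , avoids) with rs , rs∈ , refl ← unslant-steps ss∈ =
      reverse rs , ((all-reverse rs∈ , trans (foldl-reverse origin rs) end) , above) ,
      cong (map slant) (sym (reverse-involutive rs))
      where
      end : foldl _⊕_ origin rs ≡ (n , m)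
      end = slant-injective (trans (sym (foldl-slant rs)) slanted-end)

      left : All (LeftOf c ∘ slant) (vertices origin rs)
      -- `0<c` says that the origin is left of the line, which starts the induction in
      -- `avoiding⇒leftOf`.
      left = All.map⁻ (subst (All (LeftOf c)) (vertices-slant rs) (avoiding⇒leftOf p c origin ss∈ 0<c avoids))

      above : All (StrictlyAbove p v) (vertices origin (reverse rs))
      -- The reversed path is now the one in `𝓛`, so the two complementary vertices trade places.
      above = all-vertices-reverse origin rs
        (λ w u w⊕u → from (complement-leftOf u w (trans (⊕-comm u w) (trans w⊕u end)))) left

theorem3p1 : ∀ (m n p c : ℕ)
    .{{_ : NonZero m}} .{{_ : NonZero n}} .{{_ : NonZero p}} .{{_ : NonZero c}} →
    ∃[ N ]
    SlantedPathAvoiding p (+ c) (0ℤ , 0ℤ) (+ m - + p * + n , + m + + n) HasCardinality N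
    × 𝓛 p (+ c + + p * + n - + m) (0ℤ , 0ℤ) (+ n , + m) HasCardinality N
theorem3p1 m n p c@(suc _) with N , 𝓛-card ← 𝓛-finite p (+ c + + p * + n - + m) n m =
  -- The image of (n , m) has ordinate n + m, whereas the statement has m + n.
  N , subst (λ h → SlantedPathAvoiding p (+ c) origin (+ m - + p * + n , h) HasCardinality N)
            (ℤ.+-comm (+ n) (+ m)) slanted-card , 𝓛-card
  where
  slanted-card : SlantedPathAvoiding p (+ c) origin (slant p (+ n , + m)) HasCardinality N
  slanted-card = hasCardinality-image (reverse-injective ∘ map-injective (slant-injective p))
    -- Since `c` was matched as a successor, `z<s` proves that it is positive.
    (slant-avoiding p (+ c) (+ n) (+ m)) (unslant-avoiding p (+ c) (+ n) (+ m) (ℤ.+<+ z<s)) 𝓛-card
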